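{- Let $k\ge2$ be a natural number. Then $$\mathcal{R}_1(k+1,k)\le R^{\,{\mathcal{R}_1(k+1,\,k-1)\brack k-1}}(k+1,k).$$
   Context: $T_n=n(n+1)/2$, $T_0=0$. A finite set $X\subseteq\mathbb{N}$ with $|X|=T_n$, enumerated $x_1<\dots<x_{T_n}$, has $i$-th level $\{x_{T_{i-1}+1},\dots,x_{T_i}\}$ for $1\le i\le n$; $\triangle_n$ is the set of all such sets. For such sets, $X\le Y$ means $X\subseteq Y$ and every level of $X$ is contained in a single level of $Y$, distinct levels of $X$ being contained in distinct levels of $Y$; $\triangle_k(B)=\{Z\in\triangle_k:Z\le B\}$. For natural numbers $k\le p,q$, a completed game of Mines$_m(p,q,k)$ is a partition $\triangle_k(B)=X\sqcup Y$ with $B\in\triangle_m$; it is a win for player one if there is $Z\in\triangle_p(B)$ with $\triangle_k(Z)\subseteq X$, a win for player two if there is $Z\in\triangle_q(B)$ with $\triangle_k(Z)\subseteq Y$, and a draw otherwise. $\mathcal{R}_1(p,q,k)$ is the least $m\ge\max(p,q)$ such that no completed game of Mines$_m(p,q,k)$ is a draw, and $\mathcal{R}_1(n,k)=\mathcal{R}_1(n,n,k)$. The numbers ${n\brack k}$ are defined by ${n\brack0}={n\brack n}=1$ and ${n\brack k}={n-1\brack k}+\binom nk{n-1\brack k-1}$ for $0<k<n$. $R(n,k)$ is the least $N$ such that every 2-coloring of the $k$-element subsets of an $N$-element set admits an $n$-element subset all of whose $k$-element subsets have the same color; $R^1(n,k)=R(n,k)$ and $R^{l+1}(n,k)=R(R^{l}(n,k),k)$.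 -}

module Defs where

open import Data.Nat using (ℕ; zero; suc; _+_; _*_; _∸_; _≤_; _<_; _⊔_; _≡ᵇ_; _<ᵇ_)
open import Data.Nat.Combinatorics using (_C_)
open import Data.Bool using (Bool; true; false; if_then_else_)
open import Data.Fin using (Fin; toℕ)
open import Data.List using (List; length; take; drop)
open import Data.List.Relation.Unary.Linked using (Linked)
open import Data.List.Relation.Unary.All using (All)
open import Data.List.Relation.Binary.Subset.Propositional using (_⊆_)
open import Data.Product using (Σ; _×_)
open import Data.Sum using (_⊎_)
open import Relation.Binary.PropositionalEquality using (_≡_)
open import Relation.Nullary using (¬_)
open import Function.Definitions using (Injective)

T : ℕ → ℕ
T zero = 0
T (suc n) = T n + suc n

-- finite sets of naturals are represented by strictly increasing lists
StrictInc : List ℕ → Set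
StrictInc = Linked _<_

Tri : ℕ → List ℕ → Set
Tri n X = StrictInc X × length X ≡ T n

-- the (j+1)-th level (j : Fin n, 0-indexed) : positions T_j+1 .. T_{j+1}
level : {n : ℕ} → List ℕ → Fin n → List ℕ
level X j = take (suc (toℕ j)) (drop (T (toℕ j)) X)

Below : (k m : ℕ) → List ℕ → List ℕ → Set
Below k m Z B =
  Z ⊆ B ×
  Σ (Fin k → Fin m) (λ f → Injective _≡_ _≡_ f × ((i : Fin k) → level Z i ⊆ level B (f i)))

-- a completed game of Mines_m(p,q,k): B ∈ △_m together with a 2-colouring c
-- of △_k(B) (X = colour true, Y = colour false)
Win1 : (p k m : ℕ) → List ℕ → (List ℕ → Bool) → Set
Win1 p k m B c = Σ (List ℕ) λ Z → Tri p Z × Below p m Z B ×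
  ((W : List ℕ) → Tri k W → Below k p W Z → c W ≡ true)

Win2 : (q k m : ℕ) → List ℕ → (List ℕ → Bool) → Set
Win2 q k m B c = Σ (List ℕ) λ Z → Tri q Z × Below q m Z B ×
  ((W : List ℕ) → Tri k W → Below k q W Z → c W ≡ false)

Draw : (p q k m : ℕ) → List ℕ → (List ℕ → Bool) → Set
Draw p q k m B c = ¬ Win1 p k m B c × ¬ Win2 q k m B c

NoDraw : (p q k m : ℕ) → Set
NoDraw p q k m = (B : List ℕ) → Tri m B → (c : List ℕ → Bool) → ¬ Draw p q k m B c

IsR1 : (p q k m : ℕ) → Set
IsR1 p q k m = (p ⊔ q) ≤ m × NoDraw p q k m ×
  ((m' : ℕ) → (p ⊔ q) ≤ m' → m' < m → ¬ NoDraw p q k m')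

brk : ℕ → ℕ → ℕ
brk n zero = 1
brk zero (suc k) = 0
brk (suc n) (suc k) =
  if k ≡ᵇ n then 1
  else if k <ᵇ n then brk n (suc k) + (suc n C suc k) * brk n k
  else 0

RamseyProp : (n k N : ℕ) → Set
RamseyProp n k N = (c : List ℕ → Bool) →
  Σ (List ℕ) λ S → StrictInc S × length S ≡ n × All (_< N) S ×
    Σ Bool λ b → (U : List ℕ) → StrictInc U → length U ≡ k → U ⊆ S → c U ≡ b

IsR : (n k N : ℕ) → Set
IsR n k N = RamseyProp n k N × ((N' : ℕ) → N' < N → ¬ RamseyProp n k N')

data IsRIter : ℕ → ℕ → ℕ → ℕ → Set where
  one  : ∀ {n k N} → IsR n k N → IsRIter 1 n k N
  step : ∀ {l n k M N} → IsRIter (suc l) n k M → IsR M k N → IsRIter (suc (suc l)) n k N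

module Submission where

open import Defs
open import Data.Bool as Bool using (Bool; true; false; not; if_then_else_)
open import Data.Bool.Properties using (¬-not)
open import Data.Fin using (Fin; toℕ; fromℕ; inject₁; inject≤)
open import Data.Fin.Properties
  using (toℕ<n; toℕ-fromℕ; toℕ-inject₁; toℕ-inject≤; inject₁-injective; inject≤-injective; fromℕ≢inject₁)
open import Data.Fin.Relation.Unary.Top using (View; view; ‵fromℕ; ‵inj₁)
open import Data.List
  using (List; []; _∷_; [_]; _++_; length; map; take; drop; cartesianProductWith; applyUpTo; upTo)
open import Data.List.Membership.Propositional using (_∈_; find; lose)
open import Data.List.Membership.Propositional.Properties
open import Data.List.Properties
  using (≡-dec; length-++; length-map; length-take; length-drop; length-applyUpTo; length-upTo; map-upTo;
         take-map; drop-map; take-all; drop-all; take++drop≡id)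
open import Data.List.Relation.Binary.Equality.Propositional using (≋⇒≡)
open import Data.List.Relation.Binary.Sublist.Propositional
  using ([]; _∷_; _∷ʳ_; ⊆-refl; ⊆-trans; minimum) renaming (_⊆_ to _⊑_; lookup to ⊑-lookup)
open import Data.List.Relation.Binary.Sublist.Propositional.Properties
  using (All-resp-⊆; take-⊆; drop-⊆; to-≋; length-mono-≤)
  renaming (++⁺ to ⊑-++; ++⁺ˡ to ⊑-++ˡ; ++⁺ʳ to ⊑-++ʳ; map⁺ to ⊑-map)
open import Data.List.Relation.Binary.Subset.Propositional using (_⊆_)
open import Data.List.Relation.Unary.All as All using (All; []; _∷_; all?)
open import Data.List.Relation.Unary.AllPairs using (AllPairs; []; _∷_)
open import Data.List.Relation.Unary.Any using (here; there; any?)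
open import Data.List.Relation.Unary.Linked as Linked using ([])
import Data.List.Relation.Unary.Linked.Properties as Linked
open import Data.Nat
  using (ℕ; zero; suc; _+_; _*_; _∸_; _≤_; _<_; _⊓_; z≤n; s≤s; s≤s⁻¹; _≟_; _<?_; _≤′_; ≤′-refl; ≤′-step)
open import Data.Nat.Combinatorics using (_C_; nCk+nC[k+1]≡[n+1]C[k+1]; nCn≡1)
open import Data.Nat.Combinatorics.Specification using (k>n⇒nCk≡0)
open import Data.Nat.Properties
open import Data.Product using (Σ; ∃; _×_; _,_; proj₁; proj₂)
open import Data.Sum using (_⊎_; inj₁; inj₂)
open import Function using (_∘_)
open import Function.Definitions using (Injective)
open import Relation.Binary.Definitions using (tri<; tri≈; tri>)
open import Relation.Binary.PropositionalEquality
  using (_≡_; _≢_; refl; sym; trans; cong; cong₂; subst; module ≡-Reasoning)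
open import Relation.Nullary using (¬_; Dec; yes; no; does; contradiction)
open import Relation.Nullary.Decidable using (map′; dec-true; dec-false; ¬?; _×-dec_)

-- Write a = R₁(k+1,k-1). The set △_{k-1}(A) of an A ∈ △_a has brk a (k-1) members. Given B ∈ △_N,
-- let A consist of its first a levels and let L be its last level, which has N elements. Applying
-- Ramsey's theorem once for each V ∈ △_{k-1}(A) shrinks L to a set S of size k+1 such that the colour
-- of V ∪ U does not depend on U ∈ [S]^k. This colours △_{k-1}(A), so the choice of a yields
-- Z ∈ △_{k+1}(A) all of whose V have the same colour b. If some W ∈ △_k(Z) has colour b then W ∪ S is
-- a win for b, and otherwise Z is a win for the other colour.
--
-- The least m with NoDraw must be computed, so NoDraw is shown to be decidable: B can be relabelled
-- to {0, …, T_m - 1}, and then only the finitely many colourings of △_k(B) matter.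

-- Strictly increasing lists

StrictInc⇒AllPairs : ∀ {X} → StrictInc X → AllPairs _<_ X
StrictInc⇒AllPairs = Linked.Linked⇒AllPairs <-trans

AllPairs-resp-⊑ : ∀ {X Y : List ℕ} → X ⊑ Y → AllPairs _<_ Y → AllPairs _<_ X
AllPairs-resp-⊑ []         []       = []
AllPairs-resp-⊑ (_ ∷ʳ p)   (_ ∷ ps) = AllPairs-resp-⊑ p ps
AllPairs-resp-⊑ (refl ∷ p) (q ∷ ps) = All-resp-⊆ p q ∷ AllPairs-resp-⊑ p ps

StrictInc-resp-⊑ : ∀ {X Y} → X ⊑ Y → StrictInc Y → StrictInc X
StrictInc-resp-⊑ p = Linked.AllPairs⇒Linked ∘ AllPairs-resp-⊑ p ∘ StrictInc⇒AllPairs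

⊑⇒⊆ : ∀ {X Y : List ℕ} → X ⊑ Y → X ⊆ Y
⊑⇒⊆ p = ⊑-lookup p

-- `Below` speaks of `⊆`, whereas `⊑` also controls order and length. If the heads differ, `x`
-- occurs in `Y`, so `y` is smaller than `x` and hence than all of `X`, and can be skipped.
⊆⇒⊑ : ∀ {X Y} → StrictInc X → StrictInc Y → X ⊆ Y → X ⊑ Y
⊆⇒⊑ incX incY = go (StrictInc⇒AllPairs incX) (StrictInc⇒AllPairs incY)
  where
  go : ∀ {X Y} → AllPairs _<_ X → AllPairs _<_ Y → X ⊆ Y → X ⊑ Y
  go []       _        _ = minimum _
  go (_ ∷ _)  []       h with h (here refl)
  ... | ()
  go {x ∷ X} {y ∷ Y} (x< ∷ ps) (y< ∷ qs) h with x ≟ y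
  ... | yes refl = refl ∷ go ps qs λ z∈X → tail z∈X (h (there z∈X))
    where
    tail : ∀ {z} → z ∈ X → z ∈ x ∷ Y → z ∈ Y
    tail z∈X (here refl) = contradiction (All.lookup x< z∈X) (<-irrefl refl)
    tail z∈X (there z∈Y) = z∈Y
  ... | no x≢y = y ∷ʳ go (x< ∷ ps) qs λ z∈ → tail z∈ (h z∈)
    where
    x∈Y : x ∈ Y
    x∈Y with h (here refl)
    ... | here x≡y = contradiction x≡y x≢y
    ... | there p  = p
    tail : ∀ {z} → z ∈ x ∷ X → z ∈ y ∷ Y → z ∈ Y
    tail _            (there z∈Y) = z∈Y
    tail (here refl)  (here x≡y)  = contradiction x≡y x≢y
    tail (there z∈X)  (here refl) =
      contradiction (<-trans (All.lookup x< z∈X) (All.lookup y< x∈Y)) (<-irrefl refl)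

⊑-length⇒≡ : ∀ {X Y : List ℕ} → length X ≡ length Y → X ⊑ Y → X ≡ Y
⊑-length⇒≡ eq p = ≋⇒≡ (to-≋ eq p)

StrictInc-++⇒< : ∀ {X Y x y} → StrictInc (X ++ Y) → x ∈ X → y ∈ Y → x < y
StrictInc-++⇒< {X} inc = go X (StrictInc⇒AllPairs inc)
  where
  go : ∀ X {Y x y} → AllPairs _<_ (X ++ Y) → x ∈ X → y ∈ Y → x < y
  go (x ∷ X) (x< ∷ _) (here refl) y∈Y = All.lookup x< (∈-++⁺ʳ X y∈Y)
  go (_ ∷ X) (_ ∷ ps) (there x∈X) y∈Y = go X ps x∈X y∈Y

StrictInc-++ˡ : ∀ {X} Y → StrictInc (X ++ Y) → StrictInc X
StrictInc-++ˡ Y = StrictInc-resp-⊑ (⊑-++ʳ Y ⊆-refl)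

StrictInc-++ʳ : ∀ X {Y} → StrictInc (X ++ Y) → StrictInc Y
StrictInc-++ʳ X = StrictInc-resp-⊑ (⊑-++ˡ X ⊆-refl)

-- Sublists of a given length

combinations : ℕ → List ℕ → List (List ℕ)
combinations zero    _       = [ [] ]
combinations (suc k) []      = []
combinations (suc k) (x ∷ X) = map (x ∷_) (combinations k X) ++ combinations (suc k) X

length-combinations : ∀ k X → length (combinations k X) ≡ length X C k
length-combinations zero    X       = refl
length-combinations (suc k) []      = refl
length-combinations (suc k) (x ∷ X) = begin
  length (map (x ∷_) (combinations k X) ++ combinations (suc k) X)
    ≡⟨ length-++ (map (x ∷_) (combinations k X)) ⟩
  length (map (x ∷_) (combinations k X)) + length (combinations (suc k) X)
    ≡⟨ cong₂ _+_ (trans (length-map (x ∷_) (combinations k X)) (length-combinations k X))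
                 (length-combinations (suc k) X) ⟩
  length X C k + length X C suc k
    ≡⟨ nCk+nC[k+1]≡[n+1]C[k+1] (length X) k ⟩
  suc (length X) C suc k ∎
  where open ≡-Reasoning

⊑⇒∈-combinations : ∀ {U X} → U ⊑ X → U ∈ combinations (length U) X
⊑⇒∈-combinations {[]}    _          = here refl
⊑⇒∈-combinations {_ ∷ U} (x ∷ʳ p)   = ∈-++⁺ʳ (map (x ∷_) _) (⊑⇒∈-combinations p)
⊑⇒∈-combinations {_ ∷ U} (refl ∷ p) = ∈-++⁺ˡ (∈-map⁺ (_ ∷_) (⊑⇒∈-combinations p))

∈-combinations⇒⊑ : ∀ k X {U} → U ∈ combinations k X → U ⊑ X × length U ≡ k
∈-combinations⇒⊑ zero    X       (here refl) = minimum X , refl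
∈-combinations⇒⊑ (suc k) (x ∷ X) U∈ with ∈-++⁻ (map (x ∷_) (combinations k X)) U∈
... | inj₁ U∈₁ with _ , V∈ , refl ← ∈-map⁻ (x ∷_) U∈₁ =
  let p , eq = ∈-combinations⇒⊑ k X V∈ in refl ∷ p , cong suc eq
... | inj₂ U∈₂ =
  let p , eq = ∈-combinations⇒⊑ (suc k) X U∈₂ in x ∷ʳ p , eq

take-++ : ∀ m {X : List ℕ} Y → m ≤ length X → take m (X ++ Y) ≡ take m X
take-++ zero    Y m≤ = refl
take-++ (suc m) {x ∷ X} Y (s≤s m≤) = cong (x ∷_) (take-++ m Y m≤)

drop-++ : ∀ m {X : List ℕ} Y → m ≤ length X → drop m (X ++ Y) ≡ drop m X ++ Y
drop-++ zero    Y m≤ = refl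
drop-++ (suc m) {x ∷ X} Y (s≤s m≤) = drop-++ m Y m≤

take-length-++ : ∀ {m} {X : List ℕ} Y → length X ≡ m → take m (X ++ Y) ≡ X
take-length-++ {X = X} Y refl = trans (take-++ _ Y ≤-refl) (take-all _ X ≤-refl)

drop-length-++ : ∀ {m} {X : List ℕ} Y → length X ≡ m → drop m (X ++ Y) ≡ Y
drop-length-++ {X = X} Y refl = trans (drop-++ _ {X} Y ≤-refl) (cong (_++ Y) (drop-all _ X ≤-refl))

-- Levels

T-mono : ∀ {m n} → m ≤ n → T m ≤ T n
T-mono z≤n     = z≤n
T-mono (s≤s p) = +-mono-≤ (T-mono p) (s≤s p)

-- `level X i` unfolds to `levelAt X (toℕ i)`, which no longer mentions the number of levels. So
-- levels of a list and of its extensions can be compared.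
levelAt : List ℕ → ℕ → List ℕ
levelAt X j = take (suc j) (drop (T j) X)

levelAt-++ : ∀ {j X} Y → T (suc j) ≤ length X → levelAt (X ++ Y) j ≡ levelAt X j
levelAt-++ {j} {X} Y Tj< = trans
  (cong (take (suc j)) (drop-++ (T j) Y (≤-trans (m≤m+n _ _) Tj<)))
  (take-++ (suc j) Y (subst (suc j ≤_) (sym (length-drop (T j) X))
    (subst (_≤ length X ∸ T j) (m+n∸m≡n (T j) (suc j)) (∸-monoˡ-≤ (T j) Tj<))))

level-inject₁ : ∀ {n X} Y → length X ≡ T n → (i : Fin n) → level (X ++ Y) (inject₁ i) ≡ level X i
level-inject₁ Y eq i rewrite toℕ-inject₁ i =
  levelAt-++ Y (subst (T (suc (toℕ i)) ≤_) (sym eq) (T-mono (toℕ<n i)))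

level-inject≤ : ∀ {a m X} Y → length X ≡ T a → (a≤m : a ≤ m) (i : Fin a) →
                level (X ++ Y) (inject≤ i a≤m) ≡ level X i
level-inject≤ Y eq a≤m i rewrite toℕ-inject≤ i a≤m =
  levelAt-++ Y (subst (T (suc (toℕ i)) ≤_) (sym eq) (T-mono (toℕ<n i)))

level-fromℕ : ∀ {n X Y} → length X ≡ T n → length Y ≡ suc n → level (X ++ Y) (fromℕ n) ≡ Y
level-fromℕ {n} {X} {Y} eqX eqY rewrite toℕ-fromℕ n | drop-length-++ {X = X} Y eqX =
  take-all (suc n) Y (≤-reflexive eqY)

level-⊆ : ∀ {n} X (i : Fin n) → level X i ⊆ X
level-⊆ X i = ⊑⇒⊆ (⊆-trans (take-⊆ (suc (toℕ i)) _) (drop-⊆ (T (toℕ i)) X))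

level-nonempty : ∀ {n X} → length X ≡ T n → (i : Fin n) → ∃ λ x → x ∈ level X i
level-nonempty {n} {X} eq i = go (T (toℕ i)) X
  (subst (suc (T (toℕ i)) ≤_) (sym eq)
    (≤-trans (subst (suc (T (toℕ i)) ≤_) (sym (+-suc (T (toℕ i)) (toℕ i))) (s≤s (m≤m+n _ _)))
             (T-mono (toℕ<n i))))
  where
  go : ∀ m X {j} → m < length X → ∃ λ x → x ∈ take (suc j) (drop m X)
  go zero    (x ∷ X) _       = x , here refl
  go (suc m) (x ∷ X) (s≤s p) = go m X p

-- Inductions on triangles peel off the top level. Matching `split` with `refl` turns the list
-- itself into `lower ++ top`.
record Snoc (n : ℕ) (X : List ℕ) : Set where
  constructor snoc
  field
    {lower top} : List ℕ
    split       : X ≡ lower ++ top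
    length-low  : length lower ≡ T n
    length-top  : length top ≡ suc n

unsnoc : ∀ n X → length X ≡ T (suc n) → Snoc n X
unsnoc n X eq = snoc {lower = take (T n) X} {top = drop (T n) X}
  (sym (take++drop≡id (T n) X))
  (trans (length-take (T n) X) (trans (cong (T n ⊓_) eq) (m≤n⇒m⊓n≡m (m≤m+n _ _))))
  (trans (length-drop (T n) X) (trans (cong (_∸ T n) eq) (m+n∸m≡n (T n) (suc n))))

∈-level : ∀ {n} X → length X ≡ T n → ∀ {x} → x ∈ X → ∃ λ (i : Fin n) → x ∈ level X i
∈-level {zero}  (_ ∷ _) () _
∈-level {suc n} X eq x∈X with snoc {lower = A} {top = L} refl eqA eqL ← unsnoc n X eq
  with ∈-++⁻ A x∈X
... | inj₁ x∈A = let i , x∈i = ∈-level A eqA x∈A in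
  inject₁ i , subst (_ ∈_) (sym (level-inject₁ L eqA i)) x∈i
... | inj₂ x∈L = fromℕ n , subst (_ ∈_) (sym (level-fromℕ eqA eqL)) x∈L

-- The relation Below

Below-trans : ∀ {k m n X Y Z} → Below k m X Y → Below m n Y Z → Below k n X Z
Below-trans (X⊆Y , f , f-inj , hf) (Y⊆Z , g , g-inj , hg) =
  Y⊆Z ∘ X⊆Y , g ∘ f , f-inj ∘ g-inj , λ i → hg (f i) ∘ hf i

Below-++ʳ : ∀ {a m A} L → length A ≡ T a → a ≤ m → Below a m A (A ++ L)
Below-++ʳ {A = A} L eq a≤m =
  ∈-++⁺ˡ , (λ i → inject≤ i a≤m) , inject≤-injective a≤m a≤m _ _ ,
  λ i → subst (_ ∈_) (sym (level-inject≤ L eq a≤m i))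

module _ {k n : ℕ} (f : Fin k → Fin n) where

  liftTop : {i : Fin (suc k)} → View i → Fin (suc n)
  liftTop ‵fromℕ           = fromℕ n
  liftTop (‵inj₁ {i = i} _) = inject₁ (f i)

  liftTop-injective : Injective _≡_ _≡_ f → {i j : Fin (suc k)} (v : View i) (w : View j) →
                      liftTop v ≡ liftTop w → i ≡ j
  liftTop-injective inj ‵fromℕ    ‵fromℕ    eq = refl
  liftTop-injective inj ‵fromℕ    (‵inj₁ w) eq = contradiction eq fromℕ≢inject₁
  liftTop-injective inj (‵inj₁ v) ‵fromℕ    eq = contradiction (sym eq) fromℕ≢inject₁
  liftTop-injective inj (‵inj₁ v) (‵inj₁ w) eq = cong inject₁ (inj (inject₁-injective eq))

Below-++ : ∀ {k n W U A L} → length W ≡ T k → length U ≡ suc k → length A ≡ T n → length L ≡ suc n →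
           Below k n W A → U ⊆ L → Below (suc k) (suc n) (W ++ U) (A ++ L)
Below-++ {k} {n} {W} {U} {A} {L} eqW eqU eqA eqL (W⊆A , f , f-inj , hf) U⊆L =
  sub , (λ i → liftTop f (view i)) ,
  (λ {i} {j} → liftTop-injective f f-inj (view i) (view j)) , λ i → lev (view i)
  where
  sub : W ++ U ⊆ A ++ L
  sub x∈ with ∈-++⁻ W x∈
  ... | inj₁ x∈W = ∈-++⁺ˡ (W⊆A x∈W)
  ... | inj₂ x∈U = ∈-++⁺ʳ A (U⊆L x∈U)
  lev : {i : Fin (suc k)} (v : View i) → level (W ++ U) i ⊆ level (A ++ L) (liftTop f v)
  lev ‵fromℕ =
    subst (_ ∈_) (sym (level-fromℕ eqA eqL)) ∘ U⊆L ∘ subst (_ ∈_) (level-fromℕ eqW eqU)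
  lev (‵inj₁ {i = i} _) =
    subst (_ ∈_) (sym (level-inject₁ L eqA (f i))) ∘ hf i ∘ subst (_ ∈_) (level-inject₁ U eqW i)

lower-view : ∀ {n} {i : Fin (suc n)} → View i → i ≢ fromℕ n → ∃ λ j → i ≡ inject₁ j
lower-view ‵fromℕ            i≢ = contradiction refl i≢
lower-view (‵inj₁ {i = j} _) i≢ = j , refl

-- A level map that avoids the top index factors through `inject₁`.
Below-lower : ∀ {k n W A L} → length A ≡ T n → W ⊆ A →
              (f : Fin k → Fin (suc n)) → Injective _≡_ _≡_ f → (∀ i → f i ≢ fromℕ n) →
              (∀ i → level W i ⊆ level (A ++ L) (f i)) → Below k n W A
Below-lower {L = L} eqA W⊆A f f-inj f≢ hf =
  W⊆A , proj₁ ∘ low ,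
  (λ {i} {j} eq → f-inj (trans (proj₂ (low i)) (trans (cong inject₁ eq) (sym (proj₂ (low j)))))) ,
  λ i → subst (_ ∈_) (trans (cong (level _) (proj₂ (low i))) (level-inject₁ L eqA _)) ∘ hf i
  where
  low = λ i → lower-view (view (f i)) (f≢ i)

-- Converse to `Below-++`, by cases on where the level map sends the top level `U`. If it goes to
-- `L`, injectivity keeps the other levels out of `L`. Otherwise `U` lies in `A`, and `W`, which
-- precedes `U`, is forced into `A` as well.
Below-split : ∀ {k n W U A L} → length W ≡ T k → length U ≡ suc k → length A ≡ T n → length L ≡ suc n →
              StrictInc (W ++ U) → StrictInc (A ++ L) → Below (suc k) (suc n) (W ++ U) (A ++ L) →
              Below (suc k) n (W ++ U) A ⊎ (Below k n W A × U ⊆ L)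
Below-split {k} {n} {W} {U} {A} {L} eqW eqU eqA eqL incWU incAL (WU⊆AL , f , f-inj , hf) =
  go refl (view (f (fromℕ k)))
  where
  hfW : ∀ i → level W i ⊆ level (A ++ L) (f (inject₁ i))
  hfW i = hf (inject₁ i) ∘ subst (_ ∈_) (sym (level-inject₁ U eqW i))
  hfU : U ⊆ level (A ++ L) (f (fromℕ k))
  hfU = hf (fromℕ k) ∘ subst (_ ∈_) (sym (level-fromℕ eqW eqU))
  disjoint : ∀ {x} → x ∈ A → x ∈ L → ∀ {P : Set} → P
  disjoint x∈A x∈L = contradiction (StrictInc-++⇒< incAL x∈A x∈L) (<-irrefl refl)
  level-A : ∀ {i} → i ≢ fromℕ n → level (A ++ L) i ⊆ A
  level-A {i} i≢ x∈ with j , refl ← lower-view (view i) i≢ =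
    level-⊆ A j (subst (_ ∈_) (level-inject₁ L eqA j) x∈)
  go : ∀ {t} → t ≡ f (fromℕ k) → View t →
       Below (suc k) n (W ++ U) A ⊎ (Below k n W A × U ⊆ L)
  go eq ‵fromℕ = inj₂ (Below-lower eqA W⊆A (f ∘ inject₁) (inject₁-injective ∘ f-inj) f≢ hfW , U⊆L)
    where
    f≢ : ∀ i → f (inject₁ i) ≢ fromℕ n
    f≢ i h = fromℕ≢inject₁ (sym (f-inj (trans h eq)))
    W⊆A : W ⊆ A
    W⊆A x∈W = let i , x∈i = ∈-level W eqW x∈W in level-A (f≢ i) (hfW i x∈i)
    U⊆L : U ⊆ L
    U⊆L x∈U = subst (_ ∈_) (level-fromℕ eqA eqL) (subst (λ t → _ ∈ level (A ++ L) t) (sym eq) (hfU x∈U))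
  go eq (‵inj₁ _) = inj₁ (Below-lower eqA WU⊆A f f-inj f≢ hf)
    where
    U⊆A : U ⊆ A
    U⊆A x∈U = level-A (λ h → fromℕ≢inject₁ (sym (trans eq h))) (hfU x∈U)
    head-U : ∃ λ u → u ∈ U
    head-U with u , u∈ ← level-nonempty {X = W ++ U} (trans (length-++ W) (cong₂ _+_ eqW eqU)) (fromℕ k) =
      u , subst (u ∈_) (level-fromℕ eqW eqU) u∈
    WU⊆A : W ++ U ⊆ A
    WU⊆A x∈ with ∈-++⁻ W x∈
    ... | inj₂ x∈U = U⊆A x∈U
    ... | inj₁ x∈W with ∈-++⁻ A (WU⊆AL x∈)
    ...   | inj₁ x∈A = x∈A
    -- Here `x` precedes `u` because `x` is in `W`, but follows it because `u` is in `A` and `x` in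
    -- `L`.
    ...   | inj₂ x∈L = let u , u∈U = head-U in
      contradiction (<-trans (StrictInc-++⇒< incWU x∈W u∈U) (StrictInc-++⇒< incAL (U⊆A u∈U) x∈L)) (<-irrefl refl)
    -- A level sent to the top index would be a nonempty subset of both `A` and `L`.
    f≢ : ∀ i → f i ≢ fromℕ n
    f≢ i h = let x , x∈ = level-nonempty (trans (length-++ W) (cong₂ _+_ eqW eqU)) i in
      disjoint (WU⊆A (level-⊆ (W ++ U) i x∈))
               (subst (_ ∈_) (trans (cong (level (A ++ L)) h) (level-fromℕ eqA eqL)) (hf i x∈))

-- Enumeration of △_k(A)

-- The first summand collects the sets that avoid the top level of `A`, the second those whose own
-- top level lies in it. This is the recursion of the bracket numbers.
triangles : (k n : ℕ) → List ℕ → List (List ℕ)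
triangles zero    n       A = [ [] ]
triangles (suc k) zero    A = []
triangles (suc k) (suc n) A =
  triangles (suc k) n (take (T n) A) ++
  cartesianProductWith _++_ (triangles k n (take (T n) A)) (combinations (suc k) (drop (T n) A))

triangles-snoc : ∀ k n {A} L → length A ≡ T n →
  triangles (suc k) (suc n) (A ++ L) ≡
  triangles (suc k) n A ++ cartesianProductWith _++_ (triangles k n A) (combinations (suc k) L)
triangles-snoc k n {A} L eq
  rewrite take-length-++ {X = A} L eq | drop-length-++ {X = A} L eq = refl

brk-n<k : ∀ {n k} → n < k → brk n k ≡ 0
brk-n<k {zero}  {suc k} _ = refl
brk-n<k {suc n} {suc k} (s≤s n<k)
  -- The boolean tests in `brk` are the `does` fields of `_≟_` and `_<?_`, so `dec-false` evaluates
  -- them.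
  rewrite dec-false (k ≟ n) (>⇒≢ n<k) | dec-false (k <? n) (<-asym n<k) = refl

brk-diag : ∀ n → brk n n ≡ 1
brk-diag zero    = refl
brk-diag (suc n) rewrite dec-true (n ≟ n) refl = refl

-- The conditionals in `brk` disappear: for k = n the first summand is 0 and the second is 1, and
-- for k > n both vanish, the second through its binomial coefficient.
brk-suc : ∀ n k → brk (suc n) (suc k) ≡ brk n (suc k) + (suc n C suc k) * brk n k
brk-suc n k with <-cmp k n
... | tri< k<n k≢n _ rewrite dec-false (k ≟ n) k≢n | dec-true (k <? n) k<n = refl
... | tri≈ _ refl _
  rewrite dec-true (n ≟ n) refl | brk-n<k (n<1+n n) | nCn≡1 (suc n) | brk-diag n = refl
... | tri> _ k≢n n<k
  rewrite dec-false (k ≟ n) k≢n | dec-false (k <? n) (<-asym n<k)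
        | brk-n<k (m<n⇒m<1+n n<k) | k>n⇒nCk≡0 (s≤s n<k) = refl

length-cartesianProductWith : ∀ {A B C : Set} (f : A → B → C) xs ys →
  length (cartesianProductWith f xs ys) ≡ length xs * length ys
length-cartesianProductWith f []       ys = refl
length-cartesianProductWith f (x ∷ xs) ys =
  trans (length-++ (map (f x) ys))
        (cong₂ _+_ (length-map (f x) ys) (length-cartesianProductWith f xs ys))

-- This count makes the number of Ramsey steps equal to the exponent in the theorem.
length-triangles : ∀ k n {A} → length A ≡ T n → length (triangles k n A) ≡ brk n k
length-triangles zero    n       eq = refl
length-triangles (suc k) zero    eq = refl
length-triangles (suc k) (suc n) {X} eq with snoc {lower = A} {top = L} refl eqA eqL ← unsnoc n X eq = begin
  length (triangles (suc k) (suc n) (A ++ L))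
    ≡⟨ cong length (triangles-snoc k n L eqA) ⟩
  length (triangles (suc k) n A ++ cartesianProductWith _++_ (triangles k n A) (combinations (suc k) L))
    ≡⟨ length-++ (triangles (suc k) n A) ⟩
  length (triangles (suc k) n A) + length (cartesianProductWith _++_ (triangles k n A) (combinations (suc k) L))
    ≡⟨ cong₂ _+_ (length-triangles (suc k) n eqA) (length-cartesianProductWith _++_ (triangles k n A) _) ⟩
  brk n (suc k) + length (triangles k n A) * length (combinations (suc k) L)
    ≡⟨ cong (brk n (suc k) +_) (cong₂ _*_ (length-triangles k n eqA)
         (trans (length-combinations (suc k) L) (cong (_C suc k) eqL))) ⟩
  brk n (suc k) + brk n k * (suc n C suc k)
    ≡⟨ cong (brk n (suc k) +_) (*-comm (brk n k) _) ⟩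
  brk n (suc k) + (suc n C suc k) * brk n k
    ≡⟨ brk-suc n k ⟨
  brk (suc n) (suc k) ∎
  where open ≡-Reasoning

Tri-lower : ∀ n {A} L → length A ≡ T n → StrictInc (A ++ L) → Tri n A
Tri-lower n L eqA inc = StrictInc-++ˡ L inc , eqA

Tri-take : ∀ {a m B} → a ≤ m → Tri m B → Tri a (take (T a) B)
Tri-take {a} {B = B} a≤m (inc , eq) =
  StrictInc-resp-⊑ (take-⊆ (T a) B) inc ,
  trans (length-take (T a) B) (trans (cong (T a ⊓_) eq) (m≤n⇒m⊓n≡m (T-mono a≤m)))

Tri-++ : ∀ {k n W U A L} → Tri k W → length U ≡ suc k → Below k n W A → U ⊑ L →
         StrictInc (A ++ L) → Tri (suc k) (W ++ U)
Tri-++ {W = W} {L = L} (incW , eqW) eqU (W⊆A , _) U⊑L inc =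
  StrictInc-resp-⊑ (⊑-++ (⊆⇒⊑ incW (StrictInc-++ˡ L inc) W⊆A) U⊑L) inc ,
  trans (length-++ W) (cong₂ _+_ eqW eqU)

∈-triangles⁻ : ∀ k n {A W} → Tri n A → W ∈ triangles k n A → Tri k W × Below k n W A
∈-triangles⁻ zero n _ (here refl) = ([] , refl) , (λ ()) , (λ ()) , (λ { {()} }) , λ ()
∈-triangles⁻ (suc k) (suc n) {X} (inc , eq) W∈
  with snoc {lower = A} {top = L} refl eqA eqL ← unsnoc n X eq
  with triA ← Tri-lower n L eqA inc
  with ∈-++⁻ (triangles (suc k) n A) (subst (_ ∈_) (triangles-snoc k n L eqA) W∈)
... | inj₁ W∈₁ = let triW , below = ∈-triangles⁻ (suc k) n triA W∈₁ in
  triW , Below-trans below (Below-++ʳ L eqA (n≤1+n n))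
... | inj₂ W∈₂
  with V , U , V∈ , U∈ , refl ← ∈-cartesianProductWith⁻ _++_ (triangles k n A) (combinations (suc k) L) W∈₂
  with triV , below ← ∈-triangles⁻ k n triA V∈
  with U⊑L , eqU ← ∈-combinations⇒⊑ (suc k) L U∈ =
  Tri-++ triV eqU below U⊑L inc , Below-++ (proj₂ triV) eqU eqA eqL below (⊑⇒⊆ U⊑L)

-- The two cases of `Below-split` land in the two summands of `triangles`.
∈-triangles⁺ : ∀ k n {A W} → Tri n A → Tri k W → Below k n W A → W ∈ triangles k n A
∈-triangles⁺ zero n {W = []} _ _ _ = here refl
∈-triangles⁺ (suc k) zero _ _ (_ , f , _) with f Fin.zero
... | ()
∈-triangles⁺ (suc k) (suc n) {X} {Y} (incX , eqX) (incY , eqY) below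
  with snoc {lower = A} {top = L} refl eqA eqL ← unsnoc n X eqX
  with snoc {lower = V} {top = U} refl eqV eqU ← unsnoc k Y eqY
  with triA ← Tri-lower n L eqA incX
  = subst (_ ∈_) (sym (triangles-snoc k n L eqA)) (go (Below-split eqV eqU eqA eqL incY incX below))
  where
  go : Below (suc k) n (V ++ U) A ⊎ (Below k n V A × U ⊆ L) → _
  go (inj₁ below₁) = ∈-++⁺ˡ (∈-triangles⁺ (suc k) n triA (incY , eqY) below₁)
  go (inj₂ (below₂ , U⊆L)) = ∈-++⁺ʳ (triangles (suc k) n A) (∈-cartesianProductWith⁺ _++_
    (∈-triangles⁺ k n triA (Tri-lower k U eqV incY) below₂)
    (subst (λ j → U ∈ combinations j L) eqU
      (⊑⇒∈-combinations (⊆⇒⊑ (StrictInc-++ʳ V incY) (StrictInc-++ʳ A incX) U⊆L))))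

-- Relabelling

StrictMono : (ℕ → ℕ) → Set
StrictMono g = ∀ {i j} → i < j → g i < g j

-- Past the end of the list the enumeration continues with consecutive numbers, so that it is
-- strictly monotone on all of ℕ.
enumerate : ℕ → List ℕ → ℕ → ℕ
enumerate d []      i       = d + i
enumerate d (x ∷ X) zero    = x
enumerate d (x ∷ X) (suc i) = enumerate (suc x) X i

enumerate-≥ : ∀ {d X} i → All (d ≤_) X → AllPairs _<_ X → d ≤ enumerate d X i
enumerate-≥ {X = []}    i       _         _         = m≤m+n _ i
enumerate-≥ {X = _ ∷ _} zero    (d≤x ∷ _) _         = d≤x
enumerate-≥ {X = _ ∷ _} (suc i) (d≤x ∷ _) (x< ∷ ps) = ≤-trans (m≤n⇒m≤1+n d≤x) (enumerate-≥ i x< ps)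

enumerate-mono : ∀ {d X} → All (d ≤_) X → AllPairs _<_ X → StrictMono (enumerate d X)
enumerate-mono {d} {[]}    _ _         i<j = +-monoʳ-< d i<j
enumerate-mono {d} {_ ∷ _} _ (x< ∷ ps) {zero}  {suc j} _         = enumerate-≥ j x< ps
enumerate-mono {d} {_ ∷ _} _ (x< ∷ ps) {suc _} {suc _} (s≤s i<j) = enumerate-mono x< ps i<j

applyUpTo-enumerate : ∀ d X → applyUpTo (enumerate d X) (length X) ≡ X
applyUpTo-enumerate d []      = refl
applyUpTo-enumerate d (x ∷ X) = cong (x ∷_) (applyUpTo-enumerate (suc x) X)

-- `RamseyProp` speaks only of subsets of {0,...,N-1}, and `NoDraw?` inspects a single board. The
-- map `g` carries both to arbitrary increasing lists.
relabelling : ∀ {X} → StrictInc X → ∃ λ g → StrictMono g × map g (upTo (length X)) ≡ X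
relabelling {X} inc =
  enumerate 0 X ,
  enumerate-mono (All.universal (λ _ → z≤n) X) (StrictInc⇒AllPairs inc) ,
  trans (map-upTo (enumerate 0 X) (length X)) (applyUpTo-enumerate 0 X)

StrictInc-upTo : ∀ n → StrictInc (upTo n)
StrictInc-upTo n = Linked.applyUpTo⁺₂ _ n n<1+n

map-⊑⁻ : ∀ {g : ℕ → ℕ} {U} S → U ⊑ map g S → ∃ λ V → V ⊑ S × U ≡ map g V
map-⊑⁻ []      []         = [] , [] , refl
map-⊑⁻ (x ∷ S) (_ ∷ʳ p)   = let V , q , eq = map-⊑⁻ S p in V , x ∷ʳ q , eq
map-⊑⁻ (x ∷ S) (refl ∷ p) = let V , q , eq = map-⊑⁻ S p in x ∷ V , refl ∷ q , cong (_ ∷_) eq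

module _ {g : ℕ → ℕ} (mono : StrictMono g) where

  StrictMono-injective : ∀ {i j} → g i ≡ g j → i ≡ j
  StrictMono-injective {i} {j} eq with <-cmp i j
  ... | tri< i<j _ _  = contradiction (mono i<j) (<-irrefl eq)
  ... | tri≈ _ i≡j _  = i≡j
  ... | tri> _ _ j<i  = contradiction (mono j<i) (<-irrefl (sym eq))

  StrictInc-map : ∀ {X} → StrictInc X → StrictInc (map g X)
  StrictInc-map inc = Linked.map⁺ (Linked.map mono inc)

  map-⊆ : ∀ {X Y} → X ⊆ Y → map g X ⊆ map g Y
  map-⊆ X⊆Y y∈ with _ , x∈ , refl ← ∈-map⁻ g y∈ = ∈-map⁺ g (X⊆Y x∈)

  map-⊆⁻ : ∀ {X Y} → map g X ⊆ map g Y → X ⊆ Y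
  map-⊆⁻ {X} {Y} h {x} x∈X with y , y∈Y , eq ← ∈-map⁻ g (h (∈-map⁺ g x∈X)) =
    subst (_∈ Y) (sym (StrictMono-injective eq)) y∈Y

  level-map : ∀ {n} X (i : Fin n) → level (map g X) i ≡ map g (level X i)
  level-map X i = trans (cong (take (suc (toℕ i))) (drop-map (T (toℕ i)) X)) (take-map _ (drop (T (toℕ i)) X))

  Tri-map : ∀ {n X} → Tri n X → Tri n (map g X)
  Tri-map {X = X} (inc , eq) = StrictInc-map inc , trans (length-map g X) eq

  Below-map : ∀ {k n X Y} → Below k n X Y → Below k n (map g X) (map g Y)
  Below-map {X = X} {Y} (X⊆Y , f , f-inj , hf) = map-⊆ X⊆Y , f , f-inj , λ i →
    subst (_ ∈_) (sym (level-map Y (f i))) ∘ map-⊆ (hf i) ∘ subst (_ ∈_) (level-map X i)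

  Below-map⁻ : ∀ {k n X Y} → Below k n (map g X) (map g Y) → Below k n X Y
  Below-map⁻ {X = X} {Y} (X⊆Y , f , f-inj , hf) = map-⊆⁻ X⊆Y , f , f-inj , λ i →
    map-⊆⁻ (subst (_ ∈_) (level-map Y (f i)) ∘ hf i ∘ subst (_ ∈_) (sym (level-map X i)))

-- Ramsey numbers

RamseyProp-on : ∀ {n k N L} → RamseyProp n k N → StrictInc L → length L ≡ N → (c : List ℕ → Bool) →
  ∃ λ S → S ⊑ L × length S ≡ n × ∃ λ b → ∀ {U} → U ⊑ S → length U ≡ k → c U ≡ b
RamseyProp-on {L = L} ramsey inc refl c
  with g , mono , g≡ ← relabelling inc
  with S , incS , eqS , S<N , b , hb ← ramsey (c ∘ map g) =
  map g S ,
  subst (map g S ⊑_) g≡ (⊑-map g (⊆⇒⊑ incS (StrictInc-upTo (length L)) λ x∈S → ∈-upTo⁺ (All.lookup S<N x∈S))) ,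
  trans (length-map g S) eqS ,
  b , mono-col
  where
  mono-col : ∀ {U} → U ⊑ map g S → length U ≡ _ → c U ≡ b
  mono-col U⊑ eqU with V , V⊑S , refl ← map-⊑⁻ S U⊑ =
    hb V (StrictInc-resp-⊑ V⊑S incS) (trans (sym (length-map g V)) eqU) (⊑⇒⊆ V⊑S)

-- The outermost Ramsey number serves the first `W`, with `U` coloured by `c (W ++ U)`, and leaves
-- enough elements for the remaining `Ws`. Constancy for `W` survives further shrinking; the
-- constant colour may vary with `W`.
IsRIter-homogeneous : ∀ {l n k N L Ws} → IsRIter l n k N → StrictInc L → length L ≡ N →
  length Ws ≡ l → (c : List ℕ → Bool) →
  ∃ λ S → S ⊑ L × length S ≡ n ×
    (∀ {W U V} → W ∈ Ws → U ⊑ S → V ⊑ S → length U ≡ k → length V ≡ k → c (W ++ U) ≡ c (W ++ V))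
IsRIter-homogeneous {Ws = W ∷ []} (one (ramsey , _)) inc eq _ c
  with S , S⊑L , eqS , b , hb ← RamseyProp-on ramsey inc eq (c ∘ (W ++_)) =
  S , S⊑L , eqS , λ { (here refl) p q eqU eqV → trans (hb p eqU) (sym (hb q eqV)) }
IsRIter-homogeneous {Ws = W ∷ Ws} (step iter (ramsey , _)) inc eq eqWs c
  with S , S⊑L , eqS , b , hb ← RamseyProp-on ramsey inc eq (c ∘ (W ++_))
  with S′ , S′⊑S , eqS′ , h ←
    IsRIter-homogeneous {Ws = Ws} iter (StrictInc-resp-⊑ S⊑L inc) eqS (suc-injective eqWs) c =
  S′ , ⊆-trans S′⊑S S⊑L , eqS′ , λ where
    (here refl) p q eqU eqV → trans (hb (⊆-trans p S′⊑S) eqU) (sym (hb (⊆-trans q S′⊑S) eqV))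
    (there V∈)  p q eqU eqV → h V∈ p q eqU eqV

applyUpTo-⊆ : ∀ {f : ℕ → ℕ} {k M} → (∀ {i} → i < k → f i < M) → applyUpTo f k ⊆ upTo M
applyUpTo-⊆ {f} h x∈ with _ , i<k , refl ← ∈-applyUpTo⁻ f x∈ = ∈-upTo⁺ (h i<k)

-- Distinguishes the k-subsets {0,…,k-1} and {1,…,k} of {0,…,M-1}.
hasLeastZero : List ℕ → Bool
hasLeastZero (zero ∷ _) = true
hasLeastZero _          = false

-- If M = N, the homogeneous set is all of {0,...,N-1}. It then contains both {0,...,k} and
-- {1,...,k+1}, by `suc k < M`, and `hasLeastZero` separates them.
RamseyProp⇒< : ∀ {M k N} → suc k < M → RamseyProp M (suc k) N → M < N
RamseyProp⇒< {M} {k} {N} k<M ramsey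
  with S , incS , eqS , S<N , b , hb ← ramsey hasLeastZero = ≤∧≢⇒< M≤N M≢N
  where
  S⊑ : S ⊑ upTo N
  S⊑ = ⊆⇒⊑ incS (StrictInc-upTo N) λ x∈S → ∈-upTo⁺ (All.lookup S<N x∈S)
  M≤N : M ≤ N
  M≤N = subst (_≤ N) eqS (subst (length S ≤_) (length-upTo N) (length-mono-≤ S⊑))
  M≢N : M ≢ N
  M≢N refl with refl ← ⊑-length⇒≡ (trans eqS (sym (length-upTo N))) S⊑ =
    contradiction (trans (col (λ i → i) n<1+n (λ i<k → <-trans i<k k<M))
                         (sym (col suc (λ i → n<1+n (suc i)) (λ i<k → <-≤-trans (s≤s i<k) k<M)))) λ ()
    where
    col : ∀ f → (∀ i → f i < f (suc i)) → (∀ {i} → i < suc k → f i < M) →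
          hasLeastZero (applyUpTo f (suc k)) ≡ b
    col f inc f<M =
      hb _ (Linked.applyUpTo⁺₂ f (suc k) inc) (length-applyUpTo f (suc k)) (applyUpTo-⊆ f<M)

-- Each of the `l` Ramsey steps adds at least one, by `RamseyProp⇒<`.
IsRIter⇒≤ : ∀ {l n k N} → suc k < n → IsRIter l n (suc k) N → n + l ≤ N
IsRIter⇒≤ {n = n} k<n (one (ramsey , _)) =
  ≤-trans (≤-reflexive (+-comm n 1)) (RamseyProp⇒< k<n ramsey)
IsRIter⇒≤ {n = n} k<n (step {l = l} iter (ramsey , _)) =
  ≤-trans (≤-reflexive (+-suc n (suc l)))
    (≤-trans (s≤s M≥) (RamseyProp⇒< (<-≤-trans k<n (≤-trans (m≤m+n n _) M≥)) ramsey))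
  where
  M≥ = IsRIter⇒≤ k<n iter

-- Growth of the bracket numbers

nCk>0 : ∀ {n k} → k ≤ n → 0 < n C k
nCk>0 z≤n = s≤s z≤n
nCk>0 {suc n} {suc k} (s≤s k≤n) = subst (0 <_) (nCk+nC[k+1]≡[n+1]C[k+1] n k) (m≤n⇒m≤n+o _ (nCk>0 k≤n))

brk>0 : ∀ {n k} → k ≤ n → 0 < brk n k
brk>0 z≤n = s≤s z≤n
brk>0 {suc n} {suc k} (s≤s k≤n) rewrite brk-suc n k =
  m≤n⇒m≤o+n (brk n (suc k)) (*-mono-≤ (nCk>0 (s≤s k≤n)) (brk>0 k≤n))

brk-< : ∀ {n k} → k ≤ n → brk n (suc k) < brk (suc n) (suc k)
brk-< {n} {k} k≤n rewrite brk-suc n k =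
  m<m+n (brk n (suc k)) (*-mono-≤ (nCk>0 (s≤s k≤n)) (brk>0 k≤n))

-- The bracket is positive at n = k+1 and, by `brk-<`, grows by at least one whenever n does.
n<k+brk : ∀ {n k} → suc k ≤ n → n < suc k + brk n (suc k)
n<k+brk {k = k} k<n = go (≤⇒≤′ k<n)
  where
  go : ∀ {n} → suc k ≤′ n → n < suc k + brk n (suc k)
  go ≤′-refl            = m<m+n (suc k) (brk>0 {suc k} ≤-refl)
  go (≤′-step k<′n)     = ≤-<-trans (go k<′n)
    (+-monoʳ-< (suc k) (brk-< (≤-trans (n≤1+n k) (≤′⇒≤ k<′n))))

-- Games

-- Win true and Win false unfold to Win1 and Win2.
Win : Bool → (p k m : ℕ) → List ℕ → (List ℕ → Bool) → Set
Win b p k m B c = Σ (List ℕ) λ Z → Tri p Z × Below p m Z B ×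
  ((W : List ℕ) → Tri k W → Below k p W Z → c W ≡ b)

-- Both the choice of `Z` and the condition on all `W` range over finite lists, because `triangles`
-- enumerates exactly the sets below a given one.
Win? : ∀ b p k m {B} → Tri m B → (c : List ℕ → Bool) → Dec (Win b p k m B c)
Win? b p k m {B} triB c = map′ to from
  (any? (λ Z → all? (λ W → c W Bool.≟ b) (triangles k p Z)) (triangles p m B))
  where
  to : _ → Win b p k m B c
  to won with Z , Z∈ , all ← find won
             with triZ , Z≤B ← ∈-triangles⁻ p m triB Z∈ =
    Z , triZ , Z≤B , λ W triW W≤Z → All.lookup all (∈-triangles⁺ k p triZ triW W≤Z)
  from : Win b p k m B c → _
  from (Z , triZ , Z≤B , mono) = lose (∈-triangles⁺ p m triB triZ Z≤B)
    (All.tabulate λ W∈ → let triW , W≤Z = ∈-triangles⁻ k p triZ W∈ in mono _ triW W≤Z)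

Draw? : ∀ p q k m {B} → Tri m B → (c : List ℕ → Bool) → Dec (Draw p q k m B c)
Draw? p q k m triB c = ¬? (Win? true p k m triB c) ×-dec ¬? (Win? false q k m triB c)

-- `NoDraw` is a negative statement; decidability of wins extracts the winning set from it.
¬Draw⇒Win : ∀ {p k m B} → Tri m B → (c : List ℕ → Bool) → ¬ Draw p p k m B c → ∃ λ b → Win b p k m B c
¬Draw⇒Win {p} {k} {m} triB c ¬draw with Win? true p k m triB c | Win? false p k m triB c
... | yes w | _      = true , w
... | no _  | yes w  = false , w
... | no ¬w | no ¬w′ = contradiction (¬w , ¬w′) ¬draw

Win-cong : ∀ {b p k m B c c′} → Tri m B → (∀ {W} → W ∈ triangles k m B → c W ≡ c′ W) →
           Win b p k m B c → Win b p k m B c′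
Win-cong {k = k} {m} triB agree (Z , triZ , Z≤B , mono) = Z , triZ , Z≤B , λ W triW W≤Z →
  trans (sym (agree (∈-triangles⁺ k m triB triW (Below-trans W≤Z Z≤B)))) (mono W triW W≤Z)

Win-map : ∀ {g b p k m B c} → StrictMono g → Win b p k m B (c ∘ map g) → Win b p k m (map g B) c
Win-map {g} {b} {p} {k} {c = c} mono (Z , triZ , Z≤B , col) =
  map g Z , Tri-map mono {p} triZ , Below-map mono Z≤B , col′
  where
  col′ : ∀ W → Tri k W → Below k p W (map g Z) → c W ≡ b
  col′ W (incW , eqW) W≤
    -- A set below `map g Z` is itself an image, so the pulled-back colouring determines its colour.
    with V , V⊑Z , refl ← map-⊑⁻ Z (⊆⇒⊑ incW (StrictInc-map mono (proj₁ triZ)) (proj₁ W≤)) =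
    col V (StrictInc-resp-⊑ V⊑Z (proj₁ triZ) , trans (sym (length-map g V)) eqW) (Below-map⁻ mono W≤)

-- Finitely many colourings and decidability of `NoDraw`

recolour : List ℕ → Bool → (List ℕ → Bool) → List ℕ → Bool
recolour W b c V = if does (≡-dec _≟_ V W) then b else c V

colourings : List (List ℕ) → List (List ℕ → Bool)
colourings []       = [ (λ _ → true) ]
colourings (W ∷ Ws) = cartesianProductWith (recolour W) (true ∷ false ∷ []) (colourings Ws)

-- Colourings are functions on all lists, so a finite list can represent them only up to agreement
-- on `Ws`. By `Win-cong` this is enough.
colourings-complete : ∀ Ws (c : List ℕ → Bool) →
                      ∃ λ c′ → c′ ∈ colourings Ws × (∀ {W} → W ∈ Ws → c W ≡ c′ W)
colourings-complete []       c = _ , here refl , λ ()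
colourings-complete (W ∷ Ws) c with c′ , c′∈ , agree ← colourings-complete Ws c =
  recolour W (c W) c′ , ∈-cartesianProductWith⁺ (recolour W) (bool∈ (c W)) c′∈ , agree′
  where
  bool∈ : ∀ b → b ∈ true ∷ false ∷ []
  bool∈ true  = here refl
  bool∈ false = there (here refl)
  agree′ : ∀ {V} → V ∈ W ∷ Ws → c V ≡ recolour W (c W) c′ V
  agree′ {V} V∈ with ≡-dec _≟_ V W
  ... | yes refl = refl
  agree′ (here V≡W) | no V≢W = contradiction V≡W V≢W
  agree′ (there V∈) | no _   = agree V∈

NoDraw? : ∀ p q k m → Dec (NoDraw p q k m)
NoDraw? p q k m = map′ to from (all? (λ c → ¬? (Draw? p q k m triB₀ c)) (colourings (triangles k m B₀)))
  where
  B₀ = upTo (T m)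
  triB₀ : Tri m B₀
  triB₀ = StrictInc-upTo (T m) , length-upTo (T m)
  to : All (λ c → ¬ Draw p q k m B₀ c) (colourings (triangles k m B₀)) → NoDraw p q k m
  to none B (incB , eqB) c (¬w₁ , ¬w₂)
    with g , mono , g≡ ← relabelling incB
    with refl ← trans (sym g≡) (cong (map g ∘ upTo) eqB)
    with c′ , c′∈ , agree ← colourings-complete (triangles k m B₀) (c ∘ map g) =
    -- A win for `c′` on `B₀` is one for `c ∘ map g` by agreement, and then one for `c` on
    -- `map g B₀`, which is `B`. So a draw for `c` gives a draw for `c′`.
    All.lookup none c′∈
      ( ¬w₁ ∘ Win-map {b = true} mono ∘ Win-cong {b = true} triB₀ (sym ∘ agree)
      , ¬w₂ ∘ Win-map {b = false} mono ∘ Win-cong {b = false} triB₀ (sym ∘ agree))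
  from : NoDraw p q k m → All (λ c → ¬ Draw p q k m B₀ c) (colourings (triangles k m B₀))
  from noDraw = All.universal (noDraw B₀ triB₀) _

-- Linear search upwards from `l`. For `P` the `NoDraw` property and `l` the maximum of p and q, the
-- bracketed triple is `IsR1`.
least : ∀ {P : ℕ → Set} (P? : ∀ n → Dec (P n)) {l n} → l ≤ n → P n →
        ∃ λ m → (l ≤ m × P m × (∀ m′ → l ≤ m′ → m′ < m → ¬ P m′)) × m ≤ n
least {P} P? {l} l≤n Pn = go (≤⇒≤′ l≤n) Pn
  where
  Minimal : ℕ → Set
  Minimal m = l ≤ m × P m × (∀ m′ → l ≤ m′ → m′ < m → ¬ P m′)
  search : ∀ {n} → l ≤′ n → (∃ λ m → Minimal m × m < n) ⊎ (∀ m → l ≤ m → m < n → ¬ P m)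
  search ≤′-refl = inj₂ λ m l≤m m<l → contradiction m<l (≤⇒≯ l≤m)
  search (≤′-step {n} l≤′n) with search l≤′n
  ... | inj₁ (m , min , m<n) = inj₁ (m , min , m<n⇒m<1+n m<n)
  ... | inj₂ none with P? n
  ...   | yes Pn = inj₁ (n , (≤′⇒≤ l≤′n , Pn , none) , n<1+n n)
  ...   | no ¬Pn = inj₂ λ m l≤m m<1+n → none′ m l≤m (m≤n⇒m<n∨m≡n (s≤s⁻¹ m<1+n))
    where
    none′ : ∀ m → l ≤ m → m < n ⊎ m ≡ n → ¬ P m
    none′ m l≤m (inj₁ m<n)  = none m l≤m m<n
    none′ m l≤m (inj₂ refl) = ¬Pn
  go : ∀ {n} → l ≤′ n → P n → ∃ λ m → Minimal m × m ≤ n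
  go {n} l≤′n Pn with search l≤′n
  ... | inj₁ (m , min , m<n) = m , min , <⇒≤ m<n
  ... | inj₂ none            = n , (≤′⇒≤ l≤′n , Pn , none) , ≤-refl

-- The members of △_k(W ∪ S), for W ∈ △_k and S a level of size k + 1, are W itself and the sets
-- V ∪ U with V ∈ △_{k-1}(W) and U ∈ [S]^k.
Win-append : ∀ {b k m B L W S c} → length B ≡ T m → length L ≡ suc m → StrictInc (B ++ L) →
             Tri (suc k) W → Below (suc k) m W B → S ⊑ L → length S ≡ suc (suc k) → c W ≡ b →
             (∀ {V U} → Tri k V → Below k (suc k) V W → U ⊑ S → length U ≡ suc k → c (V ++ U) ≡ b) →
             Win b (suc (suc k)) (suc k) (suc m) (B ++ L) c
Win-append {b} {k} {W = W} {S} {c} eqB eqL inc triW W≤B S⊑L eqS cW≡b mono =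
  W ++ S , triWS , Below-++ (proj₂ triW) eqS eqB eqL W≤B (⊑⇒⊆ S⊑L) , col
  where
  triWS = Tri-++ triW eqS W≤B S⊑L inc
  col : ∀ Y → Tri (suc k) Y → Below (suc k) (suc (suc k)) Y (W ++ S) → c Y ≡ b
  col Y (incY , eqY) Y≤
    with snoc {lower = V} {top = U} refl eqV eqU ← unsnoc k Y eqY
    with Below-split eqV eqU (proj₂ triW) eqS incY (proj₁ triWS) Y≤
  ... | inj₁ (Y⊆W , _)
    -- A subset of `W` with as many elements as `W` is `W` itself.
    with refl ← ⊑-length⇒≡ (trans eqY (sym (proj₂ triW))) (⊆⇒⊑ incY (proj₁ triW) Y⊆W) = cW≡b
  ... | inj₂ (V≤W , U⊆S) =
    mono (Tri-lower k U eqV incY) V≤W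
         (⊆⇒⊑ (StrictInc-++ʳ V incY) (StrictInc-++ʳ W (proj₁ triWS)) U⊆S) eqU

-- Here `k` is one less than in the theorem. The last level `L` has exactly `suc m` elements, so the
-- iterated Ramsey number is taken as the number of levels of the board.
Win-step : ∀ {k a m B L} → a ≤ m → NoDraw (suc (suc k)) (suc (suc k)) k a →
           IsRIter (brk a k) (suc (suc k)) (suc k) (suc m) →
           length B ≡ T m → length L ≡ suc m → StrictInc (B ++ L) → (c : List ℕ → Bool) →
           ∃ λ b → Win b (suc (suc k)) (suc k) (suc m) (B ++ L) c
Win-step {k} {a} {m} {B} {L} a≤m noDraw iter eqB eqL inc c
  -- The role of `Ws` is played by `triangles k a A`, which has `brk a k` entries.
  with S , S⊑L , eqS , hom ← IsRIter-homogeneous iter (StrictInc-++ʳ B inc) eqL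
         (length-triangles k a (proj₂ (Tri-take a≤m (Tri-lower m L eqB inc)))) c
  = conclude (¬Draw⇒Win triA χ (noDraw A triA χ))
  where
  A = take (T a) B
  triA : Tri a A
  triA = Tri-take a≤m (Tri-lower m L eqB inc)
  A≤B : Below a m A B
  A≤B = subst (Below a m A) (take++drop≡id (T a) B) (Below-++ʳ (drop (T a) B) (proj₂ triA) a≤m)
  χ : List ℕ → Bool
  -- The first `suc k` elements of `S` serve as a representative; `hom` transfers the colour to
  -- every other choice.
  χ V = c (V ++ take (suc k) S)
  eqU : length (take (suc k) S) ≡ suc k
  eqU = trans (length-take (suc k) S) (trans (cong (suc k ⊓_) eqS) (m≤n⇒m⊓n≡m (n≤1+n (suc k))))
  conclude : (∃ λ b → Win b (suc (suc k)) k a A χ) → ∃ λ b → Win b (suc (suc k)) (suc k) (suc m) (B ++ L) c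
  conclude (b , Z , triZ , Z≤A , χ≡b)
    with any? (λ W → c W Bool.≟ b) (triangles (suc k) (suc (suc k)) Z)
  -- No set of k+1 levels below `Z` has colour `b`, so `Z` wins for the opposite colour.
  ... | no none = not b , Z , triZ ,
    Below-trans Z≤A (Below-trans A≤B (Below-++ʳ L eqB (n≤1+n m))) ,
    λ W triW W≤Z → ¬-not λ cW≡b → none (lose (∈-triangles⁺ (suc k) (suc (suc k)) triZ triW W≤Z) cW≡b)
  ... | yes some
    with W , W∈ , cW≡b ← find some
    with triW , W≤Z ← ∈-triangles⁻ (suc k) (suc (suc k)) triZ W∈ =
    b , Win-append eqB eqL inc triW (Below-trans W≤Z (Below-trans Z≤A A≤B)) S⊑L eqS cW≡b
      -- Since V ≤ W ≤ Z ≤ A, `hom` replaces `U` by the representative, and the choice of `Z` gives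
      -- colour `b`.
      λ {V} triV V≤W U⊑S eqU′ → let V≤Z = Below-trans V≤W W≤Z in
        trans (hom (∈-triangles⁺ k a triA triV (Below-trans V≤Z Z≤A)) U⊑S (take-⊆ (suc k) S) eqU′ eqU)
              (χ≡b V triV V≤Z)

-- The strict inequality `a < N` leaves a level above the first `a` ones to serve as `L`.
NoDraw-step : ∀ {k a N} → a < N → NoDraw (suc (suc k)) (suc (suc k)) k a →
              IsRIter (brk a k) (suc (suc k)) (suc k) N → NoDraw (suc (suc k)) (suc (suc k)) (suc k) N
NoDraw-step {N = suc m} (s≤s a≤m) noDraw iter X (incX , eqX) c (¬win₁ , ¬win₂)
  with snoc {lower = B} {top = L} refl eqB eqL ← unsnoc m X eqX
  with Win-step {B = B} {L} a≤m noDraw iter eqB eqL incX c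
... | true  , win = ¬win₁ win
... | false , win = ¬win₂ win

theorem8 : (k : ℕ) → 2 ≤ k →
    (a : ℕ) → IsR1 (suc k) (suc k) (k ∸ 1) a →
    (N : ℕ) → IsRIter (brk a (k ∸ 1)) (suc k) k N →
    Σ ℕ (λ m → IsR1 (suc k) (suc k) k m × m ≤ N)
theorem8 (suc zero) (s≤s ())
theorem8 k@(suc (suc j)) _ a (p≤a , noDraw , _) N iter =
  least (NoDraw? (suc k) (suc k) k) (≤-trans p≤a (<⇒≤ a<N)) (NoDraw-step a<N noDraw iter)
  where
  open ≤-Reasoning
  k≤a : suc k ≤ a
  k≤a = ≤-trans (m≤m⊔n (suc k) (suc k)) p≤a
  a<N : a < N
  -- The iteration starts at k+1 and gains at least one in each of its `brk a (k ∸ 1)` steps, which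
  -- already takes it beyond `a`.
  a<N = begin-strict
    a                        <⟨ n<k+brk (≤-trans (m≤n+m (suc j) 2) k≤a) ⟩
    suc j + brk a (suc j)    ≤⟨ +-monoˡ-≤ _ (m≤n+m (suc j) 2) ⟩
    suc k + brk a (suc j)    ≤⟨ IsRIter⇒≤ (n<1+n k) iter ⟩
    N                        ∎
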